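{- Let $k\geq 3$ be an integer and let $G$ be a connected graph on at least $k$ vertices. Then $G^{\lfloor 3k/2\rfloor}$ is $k$-ordered, and $G^{\lfloor 3k/2\rfloor+1}$ is $k$-ordered Hamiltonian.
   Context: All graphs are finite simple graphs. $d_G(v,w)$ denotes the distance in $G$ between vertices $v$ and $w$. For a positive integer $n$, the $n$-th power $G^n$ of a graph $G$ is the simple graph with the same vertex set as $G$ in which two distinct vertices $v,w$ are adjacent if and only if $d_G(v,w)\leq n$. A graph $G$ is $k$-ordered (resp. $k$-ordered Hamiltonian) if for any sequence $v_1,v_2,\dots,v_k$ of $k$ distinct vertices of $G$ there is a cycle (resp. a Hamiltonian cycle) in $G$ containing these vertices in the given order, i.e. traversing the cycle from $v_1$ in one of its two directions, one meets $v_1,v_2,\dots,v_k$ in this order before returning to $v_1$. -}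

module Defs where

open import Data.Fin using (Fin)
open import Data.Fin.Properties using (any?) renaming (_≟_ to _≟ᶠ_)
open import Data.List using (List; []; _∷_; _++_; length)
open import Data.List.Membership.Propositional using (_∈_)
open import Data.List.Relation.Binary.Sublist.Propositional using (_⊆_)
open import Data.List.Relation.Unary.Linked using (Linked)
open import Data.List.Relation.Unary.Unique.Propositional using (Unique)
open import Data.Nat using (ℕ; zero; suc; _≤_; _<_; s≤s; s≤s⁻¹)
open import Data.Nat.Properties using (anyUpTo?; allUpTo?)
open import Data.Product using (∃-syntax; _×_; _,_)
open import Function using (_∘_)
open import Level using (0ℓ)
open import Relation.Binary.Core using (Rel)
open import Relation.Binary.Definitions using (Decidable; Symmetric; Irreflexive)
open import Relation.Binary.PropositionalEquality using (_≡_; refl; sym)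
open import Relation.Nullary using (¬_; Dec)
open import Relation.Nullary.Decidable using (map′; _×-dec_; ¬?)

-- Adjacency is decidable because a finite graph is given by its finite edge
-- set; constructively this has to be recorded.
record Graph (n : ℕ) : Set₁ where
  field
    Adj    : Rel (Fin n) 0ℓ
    adj?   : Decidable Adj
    symm   : Symmetric Adj
    irrefl : Irreflexive _≡_ Adj

open Graph public

module _ {n : ℕ} (G : Graph n) where

  -- The index is the number of edges.
  data Walk : ℕ → Rel (Fin n) 0ℓ where
    nil  : ∀ {v} → Walk zero v v
    cons : ∀ {m u v w} → Adj G u v → Walk m v w → Walk (suc m) u w

  Connected : Set
  Connected = ∀ v w → ∃[ m ] Walk m v w

  -- "d_G(v,w) = d", as a relation: it holds for no d when v and w lie in
  -- different components (distance ∞).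
  Distance : Fin n → Fin n → ℕ → Set
  Distance v w d = Walk d v w × (∀ {m} → m < d → ¬ Walk m v w)

  DistanceAtMost : ℕ → Rel (Fin n) 0ℓ
  DistanceAtMost r v w = ∃[ d ] (d ≤ r × Distance v w d)

  walk? : ∀ m → Decidable (Walk m)
  walk? zero v w = map′ (λ { refl → nil }) (λ { nil → refl }) (v ≟ᶠ w)
  walk? (suc m) u w =
    map′ (λ { (_ , a , p) → cons a p }) (λ { (cons a p) → _ , a , p })
         (any? λ v → adj? G u v ×-dec walk? m v w)

  distance? : ∀ v w d → Dec (Distance v w d)
  distance? v w d = walk? d v w ×-dec allUpTo? (λ m → ¬? (walk? m v w)) d

  distanceAtMost? : ∀ r → Decidable (DistanceAtMost r)
  distanceAtMost? r v w =
    map′ (λ { (d , d<1+r , δ) → d , s≤s⁻¹ d<1+r , δ })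
         (λ { (d , d≤r , δ) → d , s≤s d≤r , δ })
         (anyUpTo? (distance? v w) (suc r))

  snoc : ∀ {m u v w} → Walk m u v → Adj G v w → Walk (suc m) u w
  snoc nil        b = cons b nil
  snoc (cons a p) b = cons a (snoc p b)

  reverseWalk : ∀ {m} → Symmetric (Walk m)
  reverseWalk nil        = nil
  reverseWalk (cons a p) = snoc (reverseWalk p) (symm G a)

  distanceAtMost-sym : ∀ {r} → Symmetric (DistanceAtMost r)
  distanceAtMost-sym (d , d≤r , p , min) =
    d , d≤r , reverseWalk p , λ m<d → min m<d ∘ reverseWalk

  -- The r-th power of G.
  power : ℕ → Graph n
  power r = record
    { Adj    = λ v w → ¬ (v ≡ w) × DistanceAtMost r v w
    ; adj?   = λ v w → ¬? (v ≟ᶠ w) ×-dec distanceAtMost? r v w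
    ; symm   = λ { (v≢w , δ) → v≢w ∘ sym , distanceAtMost-sym δ }
    ; irrefl = λ { v≡w (v≢w , _) → v≢w v≡w }
    }

  -- A list lists the vertices of a cycle once around, from a starting vertex
  -- and in a direction.  The starting vertex and direction are part of the
  -- data: every rotation or reversal of such a list is again a cycle, so
  -- "there is a cycle and one of its two directions" amounts to "there is such
  -- a list".
  data IsCycle : List (Fin n) → Set where
    cycle : ∀ {x xs} → 3 ≤ length (x ∷ xs) → Unique (x ∷ xs) →
            Linked (Adj G) (x ∷ xs ++ x ∷ []) → IsCycle (x ∷ xs)

  IsHamiltonianCycle : List (Fin n) → Set
  IsHamiltonianCycle c = IsCycle c × (∀ v → v ∈ c)

-- Traversing the cycle c from the first vertex of vs, the vertices vs are met
-- in the given order before returning to the start.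
data MeetsInOrder {n : ℕ} : (vs c : List (Fin n)) → Set where
  none : ∀ {c} → MeetsInOrder [] c
  from : ∀ {v vs xs} → vs ⊆ xs → MeetsInOrder (v ∷ vs) (v ∷ xs)

module _ {n : ℕ} (k : ℕ) (G : Graph n) where

  Ordered : Set
  Ordered = ∀ (vs : List (Fin n)) → length vs ≡ k → Unique vs →
            ∃[ c ] (IsCycle G c × MeetsInOrder vs c)

  OrderedHamiltonian : Set
  OrderedHamiltonian = ∀ (vs : List (Fin n)) → length vs ≡ k → Unique vs →
                       ∃[ c ] (IsHamiltonianCycle G c × MeetsInOrder vs c)

{-# OPTIONS --safe #-}
module Submission where

-- Put r = ⌊3k/2⌋, fix a spanning tree, and let P σ be the tree path from the
-- terminal σ to the next terminal, for those σ whose next terminal is farther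
-- than r.  Go through the vertices in the order in which the tree is grown.
-- A non-terminal vertex x is then an end of the part of P σ seen so far; give
-- it to that σ with x on P σ whose nearest own vertex on that part is farthest.
-- Along P σ, any two vertices given to the same τ ≠ σ are then separated by a
-- vertex given to σ.  So the m non-terminals of a σ-free block N of at most r
-- inner vertices of P σ have distinct owners.  With t terminals in N, counting
-- these owners together with σ gives m + 1 ≤ k; and each of them has an end
-- outside N, being far, whence m + 1 ≤ 2(k − t).  Together, 2|N| + 2 ≤ 3k, so
-- |N| < r, and σ reaches the next terminal along its own vertices.
--
-- For the Hamiltonian version the other vertices are inserted one by one, each
-- next to a neighbour.  Colour the given cycle even and an inserted vertex
-- opposite to that neighbour y; insert it after y if y is even and before y if
-- y is odd.  This preserves d(u,v) + [v odd] ≤ r + [u odd] for each step u, v.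

open import Defs
open import Data.Bool using (Bool; true; false)
open import Data.Empty using (⊥)
open import Data.Fin using (Fin)
open import Data.Fin.Properties using (any?; _≟_)
open import Data.List using (List; []; _∷_; _++_; _∷ʳ_; length; reverse; filter; map; mapMaybe; allFin; concatMap;
         initLast; _∷ʳ′_)
open import Data.List.Extrema.Nat using (argmax; argmax-all; f[xs]≤f[argmax])
open import Data.List.Membership.Propositional using (_∈_; _∉_; find)
open import Data.List.Membership.Propositional.Properties
  using (∈-∃++; ∈-++⁺ˡ; ∈-++⁺ʳ; ∈-++⁻; ∈-allFin; ∈-filter⁺; ∈-filter⁻; ∈-map⁺; ∈-map⁻; ∈-insert; ∈-concatMap⁻)
open import Data.List.Properties
  using (length-++-sucʳ; length-tabulate; length-map; length-++; map-++; map-∘; map-id; map-cong-local; ++-assoc;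
         unfold-reverse; reverse-++; reverse-involutive;
         ∷ʳ-injective; ∷-injectiveˡ; ∷-injectiveʳ; ++-identityʳ; filter-++; filter-reject)
open import Data.List.Relation.Unary.All using (All; []; _∷_)
open import Data.List.Relation.Unary.AllPairs using ([]; _∷_)
open import Data.List.Relation.Unary.Any using (here; there)
open import Data.List.Relation.Unary.Any.Properties using (reverse⁺; reverse⁻)
open import Data.List.Relation.Unary.Linked using (Linked; []; [-]; _∷_)
open import Data.List.Relation.Unary.Unique.Propositional using (Unique)
open import Data.List.Relation.Binary.Sublist.Propositional using (_⊆_; []; _∷_; ⊆-refl; ⊆-trans)
open import Data.Maybe using (Maybe; just; nothing)
open import Data.Maybe.Properties using (just-injective; ≡-dec)
open import Data.Nat using (ℕ; zero; suc; _+_; _*_; _≤_; _<_; z≤n; s≤s; s≤s⁻¹)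
open import Data.Nat.DivMod using (_/_; _%_; m≡m%n+[m/n]*n; m%n<n; /-monoˡ-≤)
open import Data.Nat.Properties
  using (≤-refl; ≤-trans; ≤-reflexive; 1+n≰n; +-suc; +-identityʳ; m≤n⇒m≤1+n; m≤m+n; m≤n+m; +-comm; +-monoˡ-≤;
         +-monoˡ-<; *-comm; *-monoʳ-≤; suc-injective; anyUpTo?; +-mono-≤; +-cancelˡ-<; *-cancelˡ-<;
         module ≤-Reasoning)
open import Data.Nat.Tactic.RingSolver using (solve-∀)
open import Data.Product using (∃-syntax; _×_; _,_; proj₁; proj₂)
open import Data.Sum using (_⊎_; inj₁; inj₂)
open import Function using (_∘_; id)
open import Relation.Binary.PropositionalEquality using (_≡_; _≢_; refl; sym; trans; cong; cong₂; subst;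
         module ≡-Reasoning)
open import Relation.Nullary using (¬_; Dec; yes; no; contradiction)
open import Relation.Nullary.Decidable using (decidable-stable; ¬?)

import Data.List.Membership.DecPropositional as DecMembership
import Data.List.Relation.Binary.Sublist.Propositional as Sublist
import Data.List.Relation.Binary.Sublist.Propositional.Properties as Sublist
import Data.List.Relation.Unary.All as All
import Data.List.Relation.Unary.All.Properties as All
import Data.List.Relation.Unary.Linked as Linked
import Data.List.Relation.Unary.Linked.Properties as Linked
import Data.List.Relation.Unary.Unique.Propositional.Properties as Unique

-- Lists: pigeonhole, splitting and reversal

module _ {A : Set} where

  Unique∧⊆⇒length≤ : ∀ {xs ys : List A} → Unique xs → (∀ {z} → z ∈ xs → z ∈ ys) → length xs ≤ length ys
  Unique∧⊆⇒length≤ []        xs⊆ys = z≤n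
  Unique∧⊆⇒length≤ {x ∷ xs} (x∉xs ∷ xs!) xs⊆ys with as , bs , refl ← ∈-∃++ (xs⊆ys (here refl)) =
    ≤-trans (s≤s (Unique∧⊆⇒length≤ xs! xs⊆as++bs)) (≤-reflexive (sym (length-++-sucʳ as x bs)))
    where
    xs⊆as++bs : ∀ {z} → z ∈ xs → z ∈ as ++ bs
    xs⊆as++bs z∈xs with ∈-++⁻ as (xs⊆ys (there z∈xs))
    ... | inj₁ z∈as         = ∈-++⁺ˡ z∈as
    ... | inj₂ (here z≡x)   = contradiction (sym z≡x) (All.lookup x∉xs z∈xs)
    ... | inj₂ (there z∈bs) = ∈-++⁺ʳ as z∈bs

  ∷ʳ≡++∷⁻ : ∀ {x z : A} xs as {bs} → xs ∷ʳ x ≡ as ++ z ∷ bs →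
            (xs ≡ as × x ≡ z) ⊎ (∃[ cs ] xs ≡ as ++ z ∷ cs)
  ∷ʳ≡++∷⁻ xs as {bs} eq with initLast bs
  ... | []       = inj₁ (∷ʳ-injective xs as eq)
  ... | cs ∷ʳ′ c = inj₂ (cs , proj₁ (∷ʳ-injective xs _ (trans eq (sym (++-assoc as (_ ∷ cs) _)))))

  reverse≡++∷++∷ : ∀ {xs : List A} as {y} bs {z} cs → reverse xs ≡ as ++ y ∷ bs ++ z ∷ cs →
                   xs ≡ reverse cs ++ z ∷ reverse bs ++ y ∷ reverse as
  reverse≡++∷++∷ {xs} as {y} bs {z} cs eq = begin
    xs                                                         ≡⟨ reverse-involutive xs ⟨
    reverse (reverse xs)                                       ≡⟨ cong reverse eq ⟩
    reverse (as ++ y ∷ bs ++ z ∷ cs)                           ≡⟨ reverse-++∷ as y (bs ++ z ∷ cs) ⟩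
    reverse (bs ++ z ∷ cs) ++ y ∷ reverse as                   ≡⟨ cong (_++ y ∷ reverse as) (reverse-++∷ bs z cs) ⟩
    (reverse cs ++ z ∷ reverse bs) ++ y ∷ reverse as           ≡⟨ ++-assoc (reverse cs) (z ∷ reverse bs) (y ∷ reverse as) ⟩
    reverse cs ++ z ∷ reverse bs ++ y ∷ reverse as             ∎
    where
    open ≡-Reasoning
    reverse-++∷ : ∀ as x bs → reverse (as ++ x ∷ bs) ≡ reverse bs ++ x ∷ reverse as
    reverse-++∷ as x bs = begin
      reverse (as ++ x ∷ bs)             ≡⟨ reverse-++ as (x ∷ bs) ⟩
      reverse (x ∷ bs) ++ reverse as     ≡⟨ cong (_++ reverse as) (unfold-reverse x bs) ⟩
      (reverse bs ∷ʳ x) ++ reverse as    ≡⟨ ++-assoc (reverse bs) (x ∷ []) (reverse as) ⟩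
      reverse bs ++ x ∷ reverse as       ∎

module _ {n : ℕ} (G : Graph n) where

  private
    V : Set
    V = Fin n

  open DecMembership (_≟_ {n}) using (_∈?_)

  -- Distances, and vertex sets grown along the edges of a connected graph

  -- Descent to a shorter walk as long as there is one; `b` bounds the length and makes the
  -- recursion structural.
  shortestWalk : ∀ b {m u v} → m ≤ b → Walk G m u v → ∃[ d ] (d ≤ m × Distance G u v d)
  shortestWalk b {m} {u} {v} m≤b p with anyUpTo? (λ j → walk? G j u v) m
  ... | no  ∄q = m , ≤-refl , p , λ j<m q → ∄q (_ , j<m , q)
  shortestWalk zero    m≤b p | yes (j , j<m , q) = contradiction (≤-trans j<m m≤b) λ ()
  shortestWalk (suc b) m≤b p | yes (j , j<m , q) with d , d≤j , δ ← shortestWalk b (s≤s⁻¹ (≤-trans j<m m≤b)) q =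
    d , ≤-trans d≤j (≤-trans (m≤n⇒m≤1+n ≤-refl) j<m) , δ

  walk⇒distanceAtMost : ∀ {m r u v} → m ≤ r → Walk G m u v → DistanceAtMost G r u v
  walk⇒distanceAtMost m≤r p with d , d≤m , δ ← shortestWalk _ ≤-refl p = d , ≤-trans d≤m m≤r , δ

  boundaryEdge : ∀ {m u v} {D : List V} → Walk G m u v → u ∈ D → v ∉ D →
                 ∃[ x ] ∃[ y ] (y ∈ D × x ∉ D × Adj G x y)
  boundaryEdge nil u∈D v∉D = contradiction u∈D v∉D
  boundaryEdge {D = D} (cons {v = w} a p) u∈D v∉D with w ∈? D
  ... | yes w∈D = boundaryEdge p w∈D v∉D
  ... | no  w∉D = w , _ , u∈D , w∉D , symm G a

  -- While `D` misses a vertex, a walk from `c` to that vertex crosses the boundary of `D`, and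
  -- `step` applies to the crossing edge. Both the growth of the spanning tree and the insertion of
  -- the remaining vertices are instances.
  exhaust : Connected G → (P : List V → Set) → (∀ {D} → P D → Unique D) →
            (∀ {D x y} → P D → y ∈ D → x ∉ D → Adj G x y →
               ∃[ D′ ] (P D′ × length D′ ≡ suc (length D) × (∀ {z} → z ∈ D → z ∈ D′))) →
            ∀ {D c} → c ∈ D → P D → ∃[ D′ ] (P D′ × (∀ v → v ∈ D′))
  exhaust conn P P! step {D₀} {c} = go n (m≤m+n n (length D₀))
    where
    go : ∀ m {D} → n ≤ m + length D → c ∈ D → P D → ∃[ D′ ] (P D′ × (∀ v → v ∈ D′))
    go m {D} bound c∈D pD with any? (λ v → ¬? (v ∈? D))
    ... | no  ∄v = D , pD , λ v → decidable-stable (v ∈? D) (λ v∉D → ∄v (v , v∉D))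
    -- `m` bounds the number of missing vertices. With `m` zero, `v` together with the distinct
    -- entries of `D` would make more than n vertices.
    go zero {D} bound c∈D pD | yes (v , v∉D) =
      contradiction (≤-trans (s≤s bound) (≤-trans (Unique∧⊆⇒length≤ (fresh v∉D ∷ P! pD) (λ _ → ∈-allFin _))
                                                   (≤-reflexive (length-tabulate id)))) 1+n≰n
      where
      fresh : v ∉ D → All (v ≢_) D
      fresh v∉D = All.tabulate λ z∈D v≡z → v∉D (subst (_∈ D) (sym v≡z) z∈D)
    go (suc m) {D} bound c∈D pD | yes (v , v∉D)
      with x , y , y∈D , x∉D , a ← boundaryEdge (proj₂ (conn c v)) c∈D v∉D
      with D′ , pD′ , len , D⊆D′ ← step pD y∈D x∉D a =
      go m (≤-trans bound (≤-reflexive (trans (sym (+-suc m _)) (cong (m +_) (sym len))))) (D⊆D′ c∈D) pD′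

  -- Spanning trees

  -- The newest vertex x comes first, with parent y.  For D = [] the condition
  -- on y is vacuous, so the root is a leaf as well.
  data Tree : List V → Set where
    empty : Tree []
    leaf  : ∀ {D} x y → Tree D → x ∉ D → (∀ z → z ∈ D → y ∈ D × Adj G x y) → Tree (x ∷ D)

  tree! : ∀ {D} → Tree D → Unique D
  tree! empty = []
  tree! (leaf {D} x y T x∉D _) = All.tabulate (λ z∈D x≡z → x∉D (subst (_∈ D) (sym x≡z) z∈D)) ∷ tree! T

  spanningTree : Connected G → V → ∃[ D ] (Tree D × (∀ v → v ∈ D))
  spanningTree conn c = exhaust conn Tree tree! (λ T y∈D x∉D a → _ , leaf _ _ T x∉D (λ _ _ → y∈D , a) , refl , there)
                          (here refl) (leaf c c empty (λ ()) (λ _ ()))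

  -- Follows the growth of the tree: when it is added, the newest vertex has its parent as only
  -- neighbour, so it is an end of every path through it.
  data Path : ∀ {D} → Tree D → V → V → List V → Set where
    single : ∀ {D x y T x∉D att} → Path (leaf {D} x y T x∉D att) x x (x ∷ [])
    up     : ∀ {D x y T x∉D att b P} → Path T y b P → Path (leaf {D} x y T x∉D att) x b (x ∷ P)
    down   : ∀ {D x y T x∉D att a P} → Path T a y P → Path (leaf {D} x y T x∉D att) a x (P ∷ʳ x)
    older  : ∀ {D x y T x∉D att a b P} → Path T a b P → Path (leaf {D} x y T x∉D att) a b P

  path : ∀ {D} (T : Tree D) {a b} → a ∈ D → b ∈ D → ∃[ P ] Path T a b P
  path (leaf x y T _ att) (here refl) (here refl) = _ , single
  path (leaf x y T _ att) (here refl) (there b∈D) = _ , up (proj₂ (path T (proj₁ (att _ b∈D)) b∈D))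
  path (leaf x y T _ att) (there a∈D) (here refl) = _ , down (proj₂ (path T a∈D (proj₁ (att _ a∈D))))
  path (leaf x y T _ att) (there a∈D) (there b∈D) = _ , older (proj₂ (path T a∈D b∈D))

  path-⊆ : ∀ {D} {T : Tree D} {a b P z} → Path T a b P → z ∈ P → z ∈ D
  path-⊆ single   (here eq)   = here eq
  path-⊆ (up p)   (here eq)   = here eq
  path-⊆ (up p)   (there z∈P) = there (path-⊆ p z∈P)
  path-⊆ (down {P = P} p) z∈  with ∈-++⁻ P z∈
  ... | inj₁ z∈P       = there (path-⊆ p z∈P)
  ... | inj₂ (here eq) = here eq
  path-⊆ (older p) z∈P = there (path-⊆ p z∈P)

  path-reverse : ∀ {D} {T : Tree D} {a b P} → Path T a b P → Path T b a (reverse P)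
  path-reverse single   = single
  path-reverse (up {x = x} {P = P} p)   = subst (Path _ _ _) (sym (unfold-reverse x P)) (down (path-reverse p))
  path-reverse (down {x = x} {P = P} p) = subst (Path _ _ _) (sym (reverse-++ P (x ∷ []))) (up (path-reverse p))
  path-reverse (older p) = older (path-reverse p)

  path-head : ∀ {D} {T : Tree D} {a b P} → Path T a b P → ∃[ Q ] P ≡ a ∷ Q
  path-head single    = _ , refl
  path-head (up p)    = _ , refl
  path-head (down p)  with Q , refl ← path-head p = _ , refl
  path-head (older p) = path-head p

  path-last : ∀ {D} {T : Tree D} {a b P} → Path T a b P → ∃[ Q ] P ≡ Q ∷ʳ b
  path-last {P = P} p with Q , eq ← path-head (path-reverse p) =
    reverse Q , trans (sym (reverse-involutive P)) (trans (cong reverse eq) (unfold-reverse _ Q))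

  start∈ : ∀ {D} {T : Tree D} {a b P} → Path T a b P → a ∈ D
  start∈ p with Q , refl ← path-head p = path-⊆ p (here refl)

  path! : ∀ {D} {T : Tree D} {a b P} → Path T a b P → Unique P
  path! single = [] ∷ []
  path! (up {x∉D = x∉D} p) = All.tabulate (λ { z∈P refl → x∉D (path-⊆ p z∈P) }) ∷ path! p
  path! (down {x∉D = x∉D} p) = Unique.++⁺ (path! p) ([] ∷ []) λ { (z∈P , here refl) → x∉D (path-⊆ p z∈P) }
  path! (older p) = path! p

  path-linked : ∀ {D} {T : Tree D} {a b P} → Path T a b P → Linked (Adj G) P
  path-linked single = [-]
  path-linked (up {att = att} p) with Q , refl ← path-head p = proj₂ (att _ (start∈ p)) ∷ path-linked p
  path-linked (down {att = att} p) with Q , refl ← path-last p =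
    linked-∷ʳ Q (path-linked p) (symm G (proj₂ (att _ (start∈ p))))
    where
    linked-∷ʳ : ∀ Q {u v} → Linked (Adj G) (Q ∷ʳ u) → Adj G u v → Linked (Adj G) ((Q ∷ʳ u) ∷ʳ v)
    linked-∷ʳ []          l       a = a ∷ [-]
    linked-∷ʳ (_ ∷ [])    (b ∷ l) a = b ∷ a ∷ [-]
    linked-∷ʳ (_ ∷ q ∷ Q) (b ∷ l) a = b ∷ linked-∷ʳ (q ∷ Q) l a
  path-linked (older p) = path-linked p

  path-interior : ∀ {D} {T : Tree D} {a b P} → a ≢ b → Path T a b P → ∃[ M ] P ≡ a ∷ M ++ b ∷ []
  path-interior a≢b p with path-head p | path-last p
  ... | Q , refl | []    , eq = contradiction (∷-injectiveˡ eq) a≢b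
  ... | Q , refl | _ ∷ M , eq = M , cong (_ ∷_) (∷-injectiveʳ eq)

  -- Defined without reference to a path, so that positions on different paths with a common start
  -- can be compared.
  treeDistance : ∀ {D} → Tree D → V → V → ℕ
  treeDistance empty            a b = 0
  treeDistance (leaf x y T _ _) a b with a ≟ x | b ≟ x
  ... | yes _ | yes _ = 0
  ... | yes _ | no  _ = suc (treeDistance T y b)
  ... | no  _ | yes _ = suc (treeDistance T a y)
  ... | no  _ | no  _ = treeDistance T a b

  -- An initial part of a tree path is itself the tree path to its last vertex, so the position of
  -- `z` does not depend on the far end `b`.
  path-index : ∀ {D} {T : Tree D} {a b P} → Path T a b P →
               ∀ as {z bs} → P ≡ as ++ z ∷ bs → length as ≡ treeDistance T a z
  path-index (single {x = x}) [] refl with x ≟ x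
  ... | yes _  = refl
  ... | no x≢x = contradiction refl x≢x
  path-index single (_ ∷ []) ()
  path-index single (_ ∷ _ ∷ _) ()
  path-index (up {x = x} p) [] refl with x ≟ x
  ... | yes _  = refl
  ... | no x≢x = contradiction refl x≢x
  path-index (up {x = x} {x∉D = x∉D} p) (_ ∷ as) {z} eq with x ≟ x | z ≟ x
  ... | no x≢x | _        = contradiction refl x≢x
  ... | yes _  | yes refl = contradiction (path-⊆ p (subst (_ ∈_) (sym (∷-injectiveʳ eq)) (∈-insert as))) x∉D
  ... | yes _  | no _     = cong suc (path-index p as (∷-injectiveʳ eq))
  path-index (down {x = x} {x∉D = x∉D} {a = a} {P = P} p) as {z} eq with a ≟ x | z ≟ x | ∷ʳ≡++∷⁻ P as eq
  ... | yes refl | _        | _                  = contradiction (start∈ p) x∉D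
  ... | no _     | yes _    | inj₁ (refl , _)    with Q , refl ← path-last p =
    trans (length-++ Q) (trans (+-suc (length Q) 0) (cong suc (trans (+-identityʳ _) (path-index p Q refl))))
  ... | no _     | no z≢x   | inj₁ (_ , x≡z)     = contradiction (sym x≡z) z≢x
  ... | no _     | yes refl | inj₂ (cs , refl)   = contradiction (path-⊆ p (∈-insert as)) x∉D
  ... | no _     | no _     | inj₂ (cs , P≡)     = path-index p as P≡
  path-index (older {x = x} {x∉D = x∉D} {a = a} p) as {z} eq with a ≟ x | z ≟ x
  ... | yes refl | _        = contradiction (start∈ p) x∉D
  ... | no _     | yes refl = contradiction (path-⊆ p (subst (_ ∈_) (sym eq) (∈-insert as))) x∉D
  ... | no _     | no _     = path-index p as eq

  -- Allocation of vertices to paths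

  -- `none` is needed for a `σ` without a path, and for a path whose trace on an older tree is
  -- empty.
  data Segment {D} (T : Tree D) : List V → Set where
    none : Segment T []
    some : ∀ {a b P} → Path T a b P → Segment T P

  segment-⊆ : ∀ {D} {T : Tree D} {P z} → Segment T P → z ∈ P → z ∈ D
  segment-⊆ (some p) = path-⊆ p

  -- The trace on the older tree of a path in the tree extended by the leaf x;
  -- if x is on the path, the trace is oriented so as to start at the parent y.
  data Restricted {D} (T : Tree D) (x y : V) (P : List V) : Set where
    avoids : Segment T P → x ∉ P → Restricted T x y P
    ends   : ∀ Q → Segment T Q → (∀ as {z bs} → Q ≡ as ++ z ∷ bs → length as ≡ treeDistance T y z) →
             P ≡ x ∷ Q ⊎ P ≡ reverse (x ∷ Q) → Restricted T x y P

  restrict : ∀ {D x y T x∉D att P} → Segment (leaf {D} x y T x∉D att) P → Restricted T x y P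
  restrict none = avoids none (λ ())
  restrict (some single) = ends [] none (λ { [] () ; (_ ∷ _) () }) (inj₁ refl)
  restrict (some (up p)) = ends _ (some p) (path-index p) (inj₁ refl)
  restrict (some (down {x = x} {P = P} p)) =
    ends (reverse P) (some (path-reverse p)) (path-index (path-reverse p))
      (inj₂ (sym (trans (unfold-reverse x (reverse P)) (cong (_∷ʳ x) (reverse-involutive P)))))
  restrict (some (older {x∉D = x∉D} p)) = avoids (some p) (x∉D ∘ path-⊆ p)

  module _ {D} {T : Tree D} {x y : V} {P : List V} where

    rest : Restricted T x y P → List V
    rest (avoids _ _)   = P
    rest (ends Q _ _ _) = Q

    rest-segment : (ρ : Restricted T x y P) → Segment T (rest ρ)
    rest-segment (avoids s _)   = s
    rest-segment (ends _ s _ _) = s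

    rest-⊆ : (ρ : Restricted T x y P) → ∀ {z} → z ∈ rest ρ → z ∈ P
    rest-⊆ (avoids _ _)            z∈ = z∈
    rest-⊆ (ends _ _ _ (inj₁ refl)) z∈ = there z∈
    rest-⊆ (ends _ _ _ (inj₂ refl)) z∈ = reverse⁺ (there z∈)

    rest-⊇ : (ρ : Restricted T x y P) → ∀ {z} → z ≢ x → z ∈ P → z ∈ rest ρ
    rest-⊇ (avoids _ _)            z≢x z∈ = z∈
    rest-⊇ (ends Q _ _ (inj₁ refl)) z≢x (here z≡x) = contradiction z≡x z≢x
    rest-⊇ (ends Q _ _ (inj₁ refl)) z≢x (there z∈) = z∈
    rest-⊇ (ends Q _ _ (inj₂ refl)) z≢x z∈ with reverse⁻ {xs = x ∷ Q} z∈
    ... | here z≡x  = contradiction z≡x z≢x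
    ... | there z∈Q = z∈Q

    rest-index : (ρ : Restricted T x y P) → x ∈ P → ∀ as {z bs} → rest ρ ≡ as ++ z ∷ bs → length as ≡ treeDistance T y z
    rest-index (avoids _ x∉P)   x∈P = contradiction x∈P x∉P
    rest-index (ends _ _ idx _) _   = idx

  _≟ᴹ_ : (c d : Maybe V) → Dec (c ≡ d)
  _≟ᴹ_ = ≡-dec _≟_

  update : V → Maybe V → (V → Maybe V) → V → Maybe V
  update x c f v with v ≟ x
  ... | yes _ = c
  ... | no  _ = f v

  update-same : ∀ x c f → update x c f x ≡ c
  update-same x c f with x ≟ x
  ... | yes _  = refl
  ... | no x≢x = contradiction refl x≢x

  update-other : ∀ {x v} c f → v ≢ x → update x c f v ≡ f v
  update-other {x} {v} c f v≢x with v ≟ x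
  ... | yes v≡x = contradiction v≡x v≢x
  ... | no  _   = refl

  Separates : (V → Maybe V) → V → List V → Set
  Separates f σ P = ∀ as {z} bs {z′} cs {τ} → P ≡ as ++ z ∷ bs ++ z′ ∷ cs →
                    f z ≡ just τ → f z′ ≡ just τ → τ ≢ σ → ∃[ w ] (w ∈ bs × f w ≡ just σ)

  separates-reverse : ∀ {f σ} P → Separates f σ P → Separates f σ (reverse P)
  separates-reverse P sep as bs cs eq fz fz′ τ≢σ
    with w , w∈ , fw ← sep (reverse cs) (reverse bs) (reverse as) (reverse≡++∷++∷ as bs cs eq) fz′ fz τ≢σ =
    w , reverse⁻ w∈ , fw

  -- Equals length Q when σ owns no vertex of Q.
  delay : (V → Maybe V) → V → List V → ℕ
  delay f σ [] = 0
  delay f σ (z ∷ Q) with f z ≟ᴹ just σ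
  ... | yes _ = 0
  ... | no  _ = suc (delay f σ Q)

  delay-≤ : ∀ f {σ z} as {bs} → f z ≡ just σ → delay f σ (as ++ z ∷ bs) ≤ length as
  delay-≤ f {σ} {z} [] fz with f z ≟ᴹ just σ
  ... | yes _ = z≤n
  ... | no ¬p = contradiction fz ¬p
  delay-≤ f {σ} (a ∷ as) fz with f a ≟ᴹ just σ
  ... | yes _ = z≤n
  ... | no  _ = s≤s (delay-≤ f as fz)

  delay-≤⁻ : ∀ f {σ z} as {bs} → f z ≢ just σ → delay f σ (as ++ z ∷ bs) ≤ length as → ∃[ w ] (w ∈ as × f w ≡ just σ)
  delay-≤⁻ f {σ} {z} [] fz≢ le with f z ≟ᴹ just σ
  ... | yes p = contradiction p fz≢
  delay-≤⁻ f {σ} {z} [] fz≢ () | no _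
  delay-≤⁻ f {σ} (a ∷ as) fz≢ le with f a ≟ᴹ just σ
  ... | yes p = a , here refl , p
  ... | no  _ with w , w∈as , fw ← delay-≤⁻ f as fz≢ (s≤s⁻¹ le) = w , there w∈as , fw

  maximiser : ∀ {Q : V → Set} → (∀ v → Dec (Q v)) → (μ : V → ℕ) →
              (∃[ τ ] (Q τ × (∀ σ → Q σ → μ σ ≤ μ τ))) ⊎ (∀ σ → ¬ Q σ)
  maximiser {Q} Q? μ with any? Q?
  ... | no  ∄v      = inj₂ λ σ q → ∄v (σ , q)
  ... | yes (v , q) = inj₁ (argmax μ v vs , argmax-all μ q (All.tabulate (proj₂ ∘ ∈-filter⁻ Q? {xs = allFin n})) ,
                            λ σ q′ → All.lookup (f[xs]≤f[argmax] v vs) (∈-filter⁺ Q? (∈-allFin σ) q′))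
    where vs = filter Q? (allFin n)

  module _ (Z : List V) where

    -- The invariant of the allocation while the tree grows: `f` names the owner of a vertex, and
    -- `P σ` is the part of the path of `σ` seen so far.
    record Schedule (P : V → List V) (f : V → Maybe V) : Set where
      field
        sound     : ∀ {z σ} → f z ≡ just σ → z ∈ P σ × z ∉ Z
        total     : ∀ {z σ} → z ∉ Z → z ∈ P σ → ∃[ τ ] f z ≡ just τ
        separates : ∀ σ → Separates f σ (P σ)

    module _ {D x y} {T : Tree D} (x∉D : x ∉ D) {P : V → List V} (ρ : ∀ σ → Restricted T x y (P σ))
             {f : V → Maybe V} (S : Schedule (λ σ → rest (ρ σ)) f) where

      open Schedule S

      -- `c` is the owner intended for the new leaf `x`, or `nothing` if `x` is a terminal or lies
      -- on no path. For a path through `x`, the delay is counted from the parent `y` outwards.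
      Longest : Maybe V → Set
      Longest c = ∀ {τ} → c ≡ just τ → (x ∈ P τ × x ∉ Z) ×
                  (∀ σ → x ∈ P σ → delay f σ (rest (ρ σ)) ≤ delay f τ (rest (ρ τ)))

      choose : ∃[ c ] (Longest c × (∀ {σ} → x ∉ Z → x ∈ P σ → ∃[ τ ] c ≡ just τ))
      choose with x ∈? Z
      ... | yes x∈Z = nothing , (λ ()) , λ x∉Z _ → contradiction x∈Z x∉Z
      ... | no  x∉Z with maximiser (λ σ → x ∈? P σ) (λ σ → delay f σ (rest (ρ σ)))
      ...   | inj₁ (τ , x∈Pτ , max) = just τ , (λ { refl → (x∈Pτ , x∉Z) , max }) , λ _ _ → τ , refl
      ...   | inj₂ ∄σ               = nothing , (λ ()) , λ {σ} _ x∈ → contradiction x∈ (∄σ σ)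

      module _ {c : Maybe V} (longest : Longest c) where

        g : V → Maybe V
        g = update x c f

        ∈D⇒≢x : ∀ {z} → z ∈ D → z ≢ x
        ∈D⇒≢x z∈D refl = x∉D z∈D

        g≡f : ∀ {z} → z ≢ x → g z ≡ f z
        g≡f = update-other c f

        f⇒g : ∀ {z σ} → f z ≡ just σ → g z ≡ just σ
        f⇒g {z} {σ} fz = trans (g≡f (∈D⇒≢x (segment-⊆ (rest-segment (ρ σ)) (proj₁ (sound fz))))) fz

        g⇒f : ∀ {z τ} → z ≢ x → g z ≡ just τ → f z ≡ just τ
        g⇒f z≢x gz = trans (sym (g≡f z≢x)) gz

        separates-old : ∀ {σ Q} → x ∉ Q → Separates f σ Q → Separates g σ Q
        separates-old x∉Q sep as bs cs refl gz gz′ τ≢σ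
          with w , w∈bs , fw ← sep as bs cs refl
                 (g⇒f (λ { refl → x∉Q (∈-insert as) }) gz)
                 (g⇒f (λ { refl → x∉Q (∈-++⁺ʳ as (there (∈-insert bs))) }) gz′) τ≢σ =
          w , w∈bs , f⇒g fw

        -- If x and z′ are both given to τ, then by rest-index z′ is as far from x
        -- on P τ as on P σ, so the choice of τ puts a vertex of σ before z′.
        separates-new : ∀ {σ Q} → Segment T Q → x ∈ P σ → rest (ρ σ) ≡ Q →
                        Separates f σ Q → Separates g σ (x ∷ Q)
        separates-new segQ x∈P _ sep (_ ∷ as) bs cs refl =
          separates-old (x∉D ∘ segment-⊆ segQ) sep as bs cs refl
        separates-new {σ} segQ x∈P req sep [] {z} bs {z′} cs {τ} refl gz gz′ τ≢σ =
          let c≡τ = trans (sym (update-same x c f)) gz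
              (x∈Pτ , _) , max = longest c≡τ
              fz′ = g⇒f (∈D⇒≢x (segment-⊆ segQ (∈-insert bs))) gz′
              ds , es , eq = ∈-∃++ (proj₁ (sound fz′))
              |ds|≡|bs| = trans (rest-index (ρ τ) x∈Pτ ds eq) (sym (rest-index (ρ σ) x∈P bs req))
              delay≤ = begin
                delay f σ (bs ++ z′ ∷ cs) ≡⟨ cong (delay f σ) req ⟨
                delay f σ (rest (ρ σ))    ≤⟨ max σ x∈P ⟩
                delay f τ (rest (ρ τ))    ≡⟨ cong (delay f τ) eq ⟩
                delay f τ (ds ++ z′ ∷ es) ≤⟨ delay-≤ f ds fz′ ⟩
                length ds                 ≡⟨ |ds|≡|bs| ⟩
                length bs                 ∎
              -- The owner of `z′` is `τ` and not `σ`, so a delay of at most `length bs` has to end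
              -- at a vertex of `bs`.
              w , w∈bs , fw = delay-≤⁻ f bs (λ fz′≡σ → τ≢σ (just-injective (trans (sym fz′) fz′≡σ))) delay≤
          in w , w∈bs , f⇒g fw
          where open ≤-Reasoning

        extend : (∀ {σ} → x ∉ Z → x ∈ P σ → ∃[ τ ] c ≡ just τ) → Schedule P g
        extend assigned = record { sound = sound′ ; total = total′ ; separates = separates′ }
          where
          sound′ : ∀ {z σ} → g z ≡ just σ → z ∈ P σ × z ∉ Z
          sound′ {z} {σ} gz with z ≟ x
          ... | yes refl = proj₁ (longest gz)
          ... | no  z≢x  with z∈ , z∉Z ← sound gz = rest-⊆ (ρ σ) z∈ , z∉Z

          total′ : ∀ {z σ} → z ∉ Z → z ∈ P σ → ∃[ τ ] g z ≡ just τ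
          total′ {z} {σ} z∉Z z∈P with z ≟ x
          ... | yes refl = assigned z∉Z z∈P
          ... | no  z≢x  = total z∉Z (rest-⊇ (ρ σ) z≢x z∈P)

          separates′ : ∀ σ → Separates g σ (P σ)
          separates′ σ with ρ σ in req | separates σ
          ... | avoids _ x∉P               | sep = separates-old x∉P sep
          ... | ends Q seg _ (inj₁ P≡)     | sep =
            subst (Separates g σ) (sym P≡)
              (separates-new seg (subst (x ∈_) (sym P≡) (here refl)) (cong rest req) sep)
          -- `Separates` does not depend on the orientation, so `x` may be moved to the front.
          ... | ends Q seg _ (inj₂ P≡)     | sep =
            subst (Separates g σ) (sym P≡) (separates-reverse (x ∷ Q)
              (separates-new seg (subst (x ∈_) (sym P≡) (reverse⁺ {xs = x ∷ Q} (here refl))) (cong rest req) sep))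

    schedule : ∀ {D} (T : Tree D) {P} → (∀ σ → Segment T (P σ)) → ∃[ f ] Schedule P f
    schedule empty seg = (λ _ → nothing) , record
      { sound     = λ ()
      ; total     = λ {_} {σ} _ z∈ → contradiction (segment-⊆ (seg σ) z∈) λ ()
      ; separates = λ _ _ _ _ _ ()
      }
    schedule (leaf x y T x∉D _) seg =
      let ρ = λ σ → restrict (seg σ)
          f , S = schedule T (λ σ → rest-segment (ρ σ))
          c , longest , assigned = choose x∉D ρ S
      in update x c f , extend x∉D ρ S longest assigned

  -- Blocks without a vertex of σ

  owner : ∀ (f : V → Maybe V) N {τ} → τ ∈ mapMaybe f N → ∃[ z ] (z ∈ N × f z ≡ just τ)
  owner f (z ∷ N) τ∈ with f z in fz
  owner f (z ∷ N) (here refl) | just _ = z , here refl , fz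
  owner f (z ∷ N) (there τ∈)  | just _ with w , w∈ , fw ← owner f N τ∈ = w , there w∈ , fw
  owner f (z ∷ N) τ∈          | nothing with w , w∈ , fw ← owner f N τ∈ = w , there w∈ , fw

  -- What `Separates f σ` amounts to on a block in which `σ` owns nothing.
  Scattered : (V → Maybe V) → List V → Set
  Scattered f N = ∀ as {z} bs {z′} cs {τ} → N ≡ as ++ z ∷ bs ++ z′ ∷ cs → f z ≡ just τ → f z′ ≢ just τ

  owners! : ∀ {f : V → Maybe V} N → Scattered f N → Unique (mapMaybe f N)
  owners! [] _ = []
  owners! {f} (z ∷ N) sc with owners! N (λ as bs cs eq → sc (z ∷ as) bs cs (cong (z ∷_) eq)) | f z in fz
  ... | N! | nothing = N!
  ... | N! | just τ  = All.tabulate fresh ∷ N!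
    where
    fresh : ∀ {σ} → σ ∈ mapMaybe f N → τ ≢ σ
    fresh σ∈ refl =
      let _ , w∈N , fw = owner f N σ∈
          bs , cs , N≡ = ∈-∃++ w∈N
      in sc [] bs cs (cong (z ∷_) N≡) fz fw

  length-filter-split : ∀ {Q : V → Set} (Q? : ∀ v → Dec (Q v)) vs →
                        length vs ≡ length (filter Q? vs) + length (filter (λ v → ¬? (Q? v)) vs)
  length-filter-split Q? [] = refl
  length-filter-split Q? (v ∷ vs) with Q? v
  ... | yes _ = cong suc (length-filter-split Q? vs)
  ... | no  _ = trans (cong suc (length-filter-split Q? vs)) (sym (+-suc _ _))

  -- The hypotheses say that within `N` exactly the vertices outside `Z` have an owner.
  length-filter+owners : ∀ (f : V → Maybe V) Z N → (∀ {z} → z ∈ N → z ∉ Z → ∃[ τ ] f z ≡ just τ) →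
                         (∀ {z τ} → f z ≡ just τ → z ∉ Z) →
                         length N ≡ length (filter (_∈? Z) N) + length (mapMaybe f N)
  length-filter+owners f Z []      tot snd = refl
  length-filter+owners f Z (z ∷ N) tot snd with z ∈? Z | f z in fz | length-filter+owners f Z N (tot ∘ there) snd
  ... | yes z∈Z | just _  | _  = contradiction z∈Z (snd fz)
  ... | yes _   | nothing | ih = cong suc ih
  ... | no _    | just _  | ih = trans (cong suc ih) (sym (+-suc _ _))
  ... | no z∉Z  | nothing | _  with () ← trans (sym fz) (proj₂ (tot (here refl) z∉Z))

  -- Two counts of the m + 1 members of `Z` formed by `σ` and the owners of the m non-terminals of
  -- `N`. They number at most k. Each of them also starts or ends outside `N`, and at most 2(k - t)
  -- of the 2k starts and ends lie there, because each of the t terminals in `N` is both a start and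
  -- an end. The sum of the two bounds is 2(m + t) + 2 ≤ 3k.
  block-bound : ∀ {Z : List V} (next : V → V) (f : V → Maybe V) {σ N} →
                (∀ {z} → z ∈ Z → z ∈ map next Z) → Unique N → σ ∈ Z → σ ∉ N →
                (∀ {z} → z ∈ N → f z ≢ just σ) → Scattered f N →
                (∀ {z} → z ∈ N → z ∉ Z → ∃[ τ ] f z ≡ just τ) →
                (∀ {z τ} → f z ≡ just τ → z ∉ Z) →
                (∀ {z τ} → z ∈ N → f z ≡ just τ → τ ∈ Z × ¬ (τ ∈ N × next τ ∈ N)) →
                2 + 2 * length N ≤ 3 * length Z
  block-bound {Z} next f {σ} {N} Z⊆next N! σ∈Z σ∉N free scattered total sound long = begin
    2 + 2 * length N                              ≡⟨ cong (λ l → 2 + 2 * l) (length-filter+owners f Z N total sound) ⟩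
    2 + 2 * (t + m)                               ≡⟨ solve₁ t m ⟩
    suc m + (suc m + (t + t))                     ≤⟨ +-mono-≤ m<k (+-mono-≤ m<out (+-mono-≤ t≤s t≤e)) ⟩
    k + ((s′ + e′) + (s + e))                     ≡⟨ solve₂ k s s′ e e′ ⟩
    k + ((s + s′) + (e + e′))                     ≡⟨ cong (k +_) (cong₂ _+_ k≡s+s′ k≡e+e′) ⟨
    k + (k + k)                                   ≡⟨ solve₃ k ⟩
    3 * k                                         ∎
    where
    open ≤-Reasoning
    -- The unprimed lists sort the members of `Z` by their own position, the primed ones by that of
    -- their successor.
    inside   = filter (_∈? N) Z
    inside′  = filter (λ v → next v ∈? N) Z
    outside  = filter (λ v → ¬? (v ∈? N)) Z
    outside′ = filter (λ v → ¬? (next v ∈? N)) Z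
    k  = length Z
    t  = length (filter (_∈? Z) N)
    m  = length (mapMaybe f N)
    s  = length inside
    s′ = length outside
    e  = length inside′
    e′ = length outside′

    k≡s+s′ : k ≡ s + s′
    k≡s+s′ = length-filter-split (_∈? N) Z

    k≡e+e′ : k ≡ e + e′
    k≡e+e′ = length-filter-split (λ v → next v ∈? N) Z

    segments! : Unique (σ ∷ mapMaybe f N)
    segments! = All.tabulate fresh ∷ owners! N scattered
      where
      fresh : ∀ {τ} → τ ∈ mapMaybe f N → σ ≢ τ
      fresh τ∈ refl with w , w∈N , fw ← owner f N τ∈ = free w∈N fw

    m<k : suc m ≤ k
    m<k = Unique∧⊆⇒length≤ segments! λ
      { (here refl) → σ∈Z
      ; (there τ∈) → let _ , w∈N , fw = owner f N τ∈ in proj₁ (long w∈N fw) }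

    segment-outside : ∀ {τ} → τ ∈ σ ∷ mapMaybe f N → τ ∈ outside ++ outside′
    segment-outside (here refl) = ∈-++⁺ˡ (∈-filter⁺ (λ v → ¬? (v ∈? N)) σ∈Z σ∉N)
    segment-outside {τ} (there τ∈) with w , w∈N , fw ← owner f N τ∈ with τ∈Z , ¬both ← long w∈N fw with τ ∈? N
    ... | no  τ∉N = ∈-++⁺ˡ (∈-filter⁺ (λ v → ¬? (v ∈? N)) τ∈Z τ∉N)
    ... | yes τ∈N = ∈-++⁺ʳ outside (∈-filter⁺ (λ v → ¬? (next v ∈? N)) τ∈Z λ nτ∈N → ¬both (τ∈N , nτ∈N))

    m<out : suc m ≤ s′ + e′
    m<out = ≤-trans (Unique∧⊆⇒length≤ segments! segment-outside) (≤-reflexive (length-++ outside))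

    t≤s : t ≤ s
    t≤s = Unique∧⊆⇒length≤ (Unique.filter⁺ (_∈? Z) N!) λ z∈ →
      let z∈N , z∈Z = ∈-filter⁻ (_∈? Z) z∈ in ∈-filter⁺ (_∈? N) z∈Z z∈N

    t≤e : t ≤ e
    t≤e = ≤-trans (Unique∧⊆⇒length≤ (Unique.filter⁺ (_∈? Z) N!) terminal⊆) (≤-reflexive (length-map next inside′))
      where
      terminal⊆ : ∀ {z} → z ∈ filter (_∈? Z) N → z ∈ map next inside′
      terminal⊆ z∈ with z∈N , z∈Z ← ∈-filter⁻ (_∈? Z) z∈ with v , v∈Z , refl ← ∈-map⁻ next (Z⊆next z∈Z) =
        ∈-map⁺ next (∈-filter⁺ (λ v → next v ∈? N) v∈Z z∈N)

    solve₁ : ∀ t m → 2 + 2 * (t + m) ≡ suc m + (suc m + (t + t))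
    solve₁ = solve-∀
    solve₂ : ∀ k s s′ e e′ → k + ((s′ + e′) + (s + e)) ≡ k + ((s + s′) + (e + e′))
    solve₂ = solve-∀
    solve₃ : ∀ k → k + (k + k) ≡ 3 * k
    solve₃ = solve-∀

  -- Shortcuts along a path, and the linkage of the terminals

  walkFromHead : ∀ {h N v} → Linked (Adj G) (h ∷ N) → v ∈ h ∷ N → ∃[ d ] (d ≤ length N × Walk G d h v)
  walkFromHead l       (here refl) = 0 , z≤n , nil
  walkFromHead (a ∷ l) (there v∈)  with d , d≤ , p ← walkFromHead l v∈ = suc d , s≤s d≤ , cons a p

  walkWithin : ∀ {N u v} → Linked (Adj G) N → u ∈ N → v ∈ N → ∃[ d ] (d ≤ length N × Walk G d u v)
  walkWithin l (here refl) v∈ with d , d≤ , p ← walkFromHead l v∈ = d , m≤n⇒m≤1+n d≤ , p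
  walkWithin l u∈@(there _) (here refl) with d , d≤ , p ← walkFromHead l u∈ = d , m≤n⇒m≤1+n d≤ , reverseWalk G p
  walkWithin (_ ∷ l) (there u∈) (there v∈) with d , d≤ , p ← walkWithin l u∈ v∈ = d , m≤n⇒m≤1+n d≤ , p

  module _ {r : ℕ} {S : V → Set} (S? : ∀ v → Dec (S v)) {b : V} where

    -- N is the block passed since the last selected vertex a.
    hop : ∀ as N M {a c} →
          (∀ bs N′ cs → as ++ N ++ M ≡ bs ++ N′ ++ cs → All (λ v → ¬ S v) N′ → length N′ ≤ r → length N′ < r) →
          Walk G (length N) a c → All (λ v → ¬ S v) N → length N < r →
          Linked (Adj G) (c ∷ M ++ b ∷ []) → Unique (a ∷ M ++ b ∷ []) →
          Linked (Adj (power G r)) (a ∷ filter S? M ++ b ∷ [])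
    hop as N [] short p N∌S N<r (e ∷ _) ((a≢b ∷ _) ∷ _) = (a≢b , walk⇒distanceAtMost N<r (snoc G p e)) ∷ [-]
    hop as N (v ∷ M) short p N∌S N<r (e ∷ l) ((a≢v ∷ a∉M) ∷ v∉M ∷ M!) with S? v
    ... | yes _  = (a≢v , walk⇒distanceAtMost N<r (snoc G p e)) ∷
                   hop (as ++ N ++ v ∷ []) [] M
                     (λ bs N′ cs eq → short bs N′ cs (trans (sym shift) eq))
                     nil [] (≤-trans (s≤s z≤n) N<r) l (v∉M ∷ M!)
      where
      shift : (as ++ N ++ v ∷ []) ++ M ≡ as ++ N ++ v ∷ M
      shift = trans (++-assoc as _ M) (cong (as ++_) (++-assoc N (v ∷ []) M))
    -- With `v` the block has length at most `r`, since `N` is shorter than `r`; `short` sharpens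
    -- this to less than `r`, which leaves room for one more edge.
    ... | no  ¬v = hop as (N ∷ʳ v) M
                     (λ bs N′ cs eq → short bs N′ cs (trans (sym shift) eq))
                     (subst (λ m → Walk G m _ v) (sym len) (snoc G p e)) N∷ʳv∌S
                     (short as (N ∷ʳ v) M (sym shift) N∷ʳv∌S (≤-trans (≤-reflexive len) N<r))
                     l (a∉M ∷ M!)
      where
      shift : as ++ (N ∷ʳ v) ++ M ≡ as ++ N ++ v ∷ M
      shift = cong (as ++_) (++-assoc N (v ∷ []) M)
      len : length (N ∷ʳ v) ≡ suc (length N)
      len = trans (length-++ N) (trans (+-suc _ 0) (cong suc (+-identityʳ _)))
      N∷ʳv∌S : All (λ v → ¬ S v) (N ∷ʳ v)
      N∷ʳv∌S = All.++⁺ N∌S (¬v ∷ [])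

  infix-unique : ∀ as N {cs} → Unique {A = V} (as ++ N ++ cs) → Unique N
  infix-unique (_ ∷ as) N (_ ∷ u)  = infix-unique as N u
  infix-unique [] []      _        = []
  infix-unique [] (_ ∷ N) (x∉ ∷ u) = All.++⁻ˡ N x∉ ∷ infix-unique [] N u

  infix-linked : ∀ as N {cs} → Linked (Adj G) (as ++ N ++ cs) → Linked (Adj G) N
  infix-linked (_ ∷ as) N           l       = infix-linked as N (Linked.tail l)
  infix-linked [] []                _       = []
  infix-linked [] (_ ∷ [])          _       = [-]
  infix-linked [] (_ ∷ y ∷ N)       (a ∷ l) = a ∷ infix-linked [] (y ∷ N) l

  separates-infix : ∀ {f σ} as {N} cs → Separates f σ (as ++ N ++ cs) → Separates f σ N
  separates-infix as cs sep as′ {z} bs {z′} cs′ refl = sep (as ++ as′) bs (cs′ ++ cs) eq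
    where
    open ≡-Reasoning
    eq : as ++ (as′ ++ z ∷ bs ++ z′ ∷ cs′) ++ cs ≡ (as ++ as′) ++ z ∷ bs ++ z′ ∷ cs′ ++ cs
    eq = begin
      as ++ (as′ ++ z ∷ bs ++ z′ ∷ cs′) ++ cs   ≡⟨ cong (as ++_) (++-assoc as′ _ cs) ⟩
      as ++ as′ ++ z ∷ (bs ++ z′ ∷ cs′) ++ cs   ≡⟨ cong (λ ds → as ++ as′ ++ z ∷ ds) (++-assoc bs _ cs) ⟩
      as ++ as′ ++ z ∷ bs ++ z′ ∷ cs′ ++ cs     ≡⟨ ++-assoc as as′ _ ⟨
      (as ++ as′) ++ z ∷ bs ++ z′ ∷ cs′ ++ cs   ∎

  -- A system of paths in the `r`-th power, from each terminal to its successor, with disjoint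
  -- interiors free of terminals; `inner σ` omits both ends.
  record Linkage (Z : List V) (next : V → V) (r : ℕ) : Set where
    field
      inner           : V → List V
      inner!          : ∀ σ → Unique (inner σ)
      inner-disjoint  : ∀ {σ τ z} → z ∈ inner σ → z ∈ inner τ → σ ≡ τ
      inner-avoids    : ∀ {σ z} → z ∈ inner σ → z ∉ Z
      inner-linked    : ∀ {σ} → σ ∈ Z → σ ≢ next σ → Linked (Adj (power G r)) (σ ∷ inner σ ++ next σ ∷ [])

  module _ (conn : Connected G) {Z : List V} {next : V → V} {r : ℕ} (c : V)
           (next∈Z : ∀ {z} → z ∈ Z → next z ∈ Z) (Z⊆next : ∀ {z} → z ∈ Z → z ∈ map next Z)
           (0<r : 0 < r) (3k<2+2r : 3 * length Z < 2 + 2 * r) where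

    -- Only a terminal far from its successor receives a tree path, so every owner is far from its
    -- successor.
    data Route {D} (T : Tree D) (σ : V) : List V → Set where
      direct : (σ ∈ Z → DistanceAtMost G r σ (next σ)) → Route T σ []
      detour : ∀ {P} → σ ∈ Z → ¬ DistanceAtMost G r σ (next σ) → Path T σ (next σ) P → Route T σ P

    route : ∀ {D} (T : Tree D) → (∀ v → v ∈ D) → ∀ σ → ∃[ P ] Route T σ P
    route T all∈ σ with σ ∈? Z | distanceAtMost? G r σ (next σ)
    ... | no  σ∉Z | _        = [] , direct (λ σ∈Z → contradiction σ∈Z σ∉Z)
    ... | yes _   | yes near = [] , direct (λ _ → near)
    ... | yes σ∈Z | no  far  with P , p ← path T (all∈ σ) (all∈ (next σ)) = P , detour σ∈Z far p

    route-segment : ∀ {D} {T : Tree D} {σ P} → Route T σ P → Segment T P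
    route-segment (direct _)     = none
    route-segment (detour _ _ p) = some p

    route-far : ∀ {D} {T : Tree D} {σ P z} → Route T σ P → z ∈ P → σ ∈ Z × ¬ DistanceAtMost G r σ (next σ)
    route-far (detour σ∈Z far _) _ = σ∈Z , far

    module _ {D} {T : Tree D} {P : V → List V} (routes : ∀ σ → Route T σ (P σ))
             {f : V → Maybe V} (S : Schedule Z P f) where

      open Schedule S

      owned : V → V → Set
      owned σ z = f z ≡ just σ

      owned? : ∀ σ z → Dec (owned σ z)
      owned? σ z = f z ≟ᴹ just σ

      -- By `block-bound`, 2 + 2|N| ≤ 3k < 2 + 2r. The premise |N| ≤ r is what forces owners out of
      -- `N`: if `τ` and `next τ` both lay in `N`, a walk along `N` would bring them within distance
      -- `r`, whereas an owner is far from its successor.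
      shortBlock : ∀ {σ} → σ ∈ Z → ∀ M bs N cs → P σ ≡ σ ∷ M ++ next σ ∷ [] → Unique (P σ) → Linked (Adj G) (P σ) →
                   M ≡ bs ++ N ++ cs → All (λ z → ¬ owned σ z) N → length N ≤ r → length N < r
      shortBlock {σ} σ∈Z M bs N cs P≡ P! Plinked refl free N≤r =
        *-cancelˡ-< 2 (length N) r (+-cancelˡ-< 2 _ _ (≤-trans (s≤s bound) 3k<2+2r))
        where
        P≡′ : P σ ≡ (σ ∷ bs) ++ N ++ cs ++ next σ ∷ []
        P≡′ = trans P≡ (cong (σ ∷_) (trans (++-assoc bs (N ++ cs) _) (cong (bs ++_) (++-assoc N cs _))))

        N⊆P : ∀ {z} → z ∈ N → z ∈ P σ
        N⊆P z∈N = subst (_ ∈_) (sym P≡′) (∈-++⁺ʳ (σ ∷ bs) (∈-++⁺ˡ z∈N))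

        σ∉N : σ ∉ N
        σ∉N σ∈N with σ∉ ∷ _ ← subst Unique P≡′ P! = All.lookup σ∉ (∈-++⁺ʳ bs (∈-++⁺ˡ σ∈N)) refl

        scattered : Scattered f N
        scattered as′ bs′ cs′ N≡ fz fz′
          with w , w∈ , fw ← separates-infix (σ ∷ bs) (cs ++ next σ ∷ []) (subst (Separates f σ) P≡′ (separates σ))
                               as′ bs′ cs′ N≡ fz fz′
                               (λ { refl → All.lookup free (subst (_ ∈_) (sym N≡) (∈-insert as′)) fz }) =
          All.lookup free (subst (_ ∈_) (sym N≡) (∈-++⁺ʳ as′ (there (∈-++⁺ˡ w∈)))) fw

        far : ∀ {z τ} → z ∈ N → f z ≡ just τ → τ ∈ Z × ¬ (τ ∈ N × next τ ∈ N)
        far {τ = τ} _ fz with τ∈Z , ¬near ← route-far (routes τ) (proj₁ (sound fz)) = τ∈Z , λ (τ∈N , nτ∈N) →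
          let d , d≤ , p = walkWithin (infix-linked (σ ∷ bs) N (subst (Linked _) P≡′ Plinked)) τ∈N nτ∈N
          in ¬near (walk⇒distanceAtMost (≤-trans d≤ N≤r) p)

        bound : 2 + 2 * length N ≤ 3 * length Z
        bound = block-bound next f Z⊆next (infix-unique (σ ∷ bs) N (subst Unique P≡′ P!)) σ∈Z σ∉N
                  (All.lookup free) scattered (λ z∈N z∉Z → total z∉Z (N⊆P z∈N)) (proj₂ ∘ sound) far

      -- Both ends are terminals and hence have no owner.
      filter-interior : ∀ {σ} → σ ∈ Z → ∀ M → filter (owned? σ) (σ ∷ M ++ next σ ∷ []) ≡ filter (owned? σ) M
      filter-interior {σ} σ∈Z M = begin
        filter (owned? σ) (σ ∷ M ++ next σ ∷ [])                    ≡⟨ filter-reject (owned? σ) (λ fσ → proj₂ (sound fσ) σ∈Z) ⟩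
        filter (owned? σ) (M ++ next σ ∷ [])                        ≡⟨ filter-++ (owned? σ) M (next σ ∷ []) ⟩
        filter (owned? σ) M ++ filter (owned? σ) (next σ ∷ [])      ≡⟨ cong (filter (owned? σ) M ++_)
                                                                       (filter-reject (owned? σ) (λ fnσ → proj₂ (sound fnσ) (next∈Z σ∈Z))) ⟩
        filter (owned? σ) M ++ []                                   ≡⟨ ++-identityʳ _ ⟩
        filter (owned? σ) M                                         ∎
        where open ≡-Reasoning

      join : ∀ {σ} → σ ∈ Z → σ ≢ next σ → Linked (Adj (power G r)) (σ ∷ filter (owned? σ) (P σ) ++ next σ ∷ [])
      join {σ} σ∈Z σ≢next with P σ in P≡ | routes σ
      ... | .[] | direct near = (σ≢next , near σ∈Z) ∷ [-]
      ... | Q   | detour _ _ p with M , refl ← path-interior σ≢next p =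
        subst (λ F → Linked (Adj (power G r)) (σ ∷ F ++ next σ ∷ [])) (sym (filter-interior σ∈Z M))
          (hop (owned? σ) [] [] M
            (λ bs N cs → shortBlock σ∈Z M bs N cs P≡ (subst Unique (sym P≡) (path! p)) (subst (Linked _) (sym P≡) (path-linked p)))
            nil [] 0<r (path-linked p) (path! p))

      linkageOf : Linkage Z next r
      linkageOf = record
        { inner          = λ σ → filter (owned? σ) (P σ)
        ; inner!         = λ σ → Unique.filter⁺ (owned? σ) (segment-unique (route-segment (routes σ)))
        ; inner-disjoint = λ {σ} {τ} z∈σ z∈τ → just-injective (trans (sym (fz σ z∈σ)) (fz τ z∈τ))
        ; inner-avoids   = λ {σ} z∈ → proj₂ (sound (fz σ z∈))
        ; inner-linked   = join
        }
        where
        fz : ∀ {z} σ → z ∈ filter (owned? σ) (P σ) → f z ≡ just σ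
        fz σ z∈ = proj₂ (∈-filter⁻ (owned? σ) {xs = P σ} z∈)
        segment-unique : ∀ {Q} → Segment T Q → Unique Q
        segment-unique none     = []
        segment-unique (some p) = path! p

    linkage : Linkage Z next r
    linkage =
      let D , T , all∈ = spanningTree conn c
          routes = route T all∈
          f , S = schedule Z T (λ σ → route-segment (proj₂ (routes σ)))
      in linkageOf (λ σ → proj₂ (routes σ)) S

  -- The cycle through the terminals

  -- With `ys` the rotation of `xs` by one place, `g` is the cyclic successor; off `xs` it takes the
  -- default value `c`.
  interpolate : ∀ {xs ys : List V} → V → Unique xs → length xs ≡ length ys → ∃[ g ] map g xs ≡ ys
  interpolate {[]}     {[]}     c _ _ = (λ _ → c) , refl
  interpolate {x ∷ xs} {y ∷ ys} c (x∉xs ∷ xs!) eq with g , refl ← interpolate {ys = ys} c xs! (suc-injective eq) =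
    h , cong₂ _∷_ hx≡y (map-cong-local (All.map hz≡gz x∉xs))
    where
    h : V → V
    h z with z ≟ x
    ... | yes _ = y
    ... | no  _ = g z
    hx≡y : h x ≡ y
    hx≡y with x ≟ x
    ... | yes _  = refl
    ... | no x≢x = contradiction refl x≢x
    hz≡gz : ∀ {z} → x ≢ z → h z ≡ g z
    hz≡gz {z} x≢z with z ≟ x
    ... | yes z≡x = contradiction (sym z≡x) x≢z
    ... | no  _   = refl

  linked-≢-cyclic : ∀ {x y xs} → Unique {A = V} (x ∷ y ∷ xs) → Linked _≢_ (x ∷ y ∷ xs ++ x ∷ [])
  linked-≢-cyclic {x} {y} {xs} ((x≢y ∷ x∉xs) ∷ xs!) =
    x≢y ∷ Linked.AllPairs⇒Linked (Unique.++⁺ xs! ([] ∷ []) λ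
      { (here refl , here refl) → x≢y refl
      ; (there x∈xs , here refl) → All.lookup x∉xs x∈xs refl })

  -- The equation expresses that `g` sends each entry to the following one and the last to `c`, in a
  -- form that passes to the tail. `round-linked` uses the same form.
  successor-≢ : ∀ {g : V → V} x xs {c} → map g (x ∷ xs) ≡ xs ++ c ∷ [] → Linked _≢_ (x ∷ xs ++ c ∷ []) →
                All (λ z → z ≢ g z) (x ∷ xs)
  successor-≢ x []       refl (x≢c ∷ _) = x≢c ∷ []
  successor-≢ x (y ∷ xs) eq   (x≢y ∷ l) =
    (λ x≡gx → x≢y (trans x≡gx (∷-injectiveˡ eq))) ∷ successor-≢ y xs (∷-injectiveʳ eq) l

  linked-glue : ∀ {R : V → V → Set} xs {y ys} → Linked R (xs ++ y ∷ []) → Linked R (y ∷ ys) → Linked R (xs ++ y ∷ ys)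
  linked-glue []           _       l′ = l′
  linked-glue (_ ∷ [])     (r ∷ _) l′ = r ∷ l′
  linked-glue (_ ∷ x ∷ xs) (r ∷ l) l′ = r ∷ linked-glue (x ∷ xs) l l′

  module _ {Z : List V} {next : V → V} {r : ℕ} (L : Linkage Z next r) where

    open Linkage L

    round : List V → List V
    round = concatMap (λ σ → σ ∷ inner σ)

    ⊆-round : ∀ vs → vs ⊆ round vs
    ⊆-round []       = []
    ⊆-round (v ∷ vs) = refl ∷ Sublist.++⁺ˡ (inner v) (⊆-round vs)

    round-linked : ∀ x xs {c} → map next (x ∷ xs) ≡ xs ++ c ∷ [] →
                   All (λ σ → Linked (Adj (power G r)) (σ ∷ inner σ ++ next σ ∷ [])) (x ∷ xs) →
                   Linked (Adj (power G r)) (round (x ∷ xs) ++ c ∷ [])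
    round-linked x [] refl (l ∷ []) =
      subst (λ ys → Linked (Adj (power G r)) (x ∷ ys ++ _ ∷ [])) (sym (++-identityʳ (inner x))) l
    round-linked x (y ∷ xs) {c} eq (l ∷ ls) =
      subst (Linked (Adj (power G r))) (sym (++-assoc (x ∷ inner x) (round (y ∷ xs)) (c ∷ [])))
        (linked-glue (x ∷ inner x)
          (subst (λ z → Linked (Adj (power G r)) (x ∷ inner x ++ z ∷ [])) (∷-injectiveˡ eq) l)
          (round-linked y xs (∷-injectiveʳ eq) ls))

    round-unique : ∀ vs → (∀ {v} → v ∈ vs → v ∈ Z) → Unique vs → Unique (round vs)
    round-unique []       _    _           = []
    round-unique (v ∷ vs) vs⊆Z (v∉vs ∷ vs!) =
      Unique.++⁺ (All.tabulate (λ { v∈ refl → inner-avoids v∈ (vs⊆Z (here refl)) }) ∷ inner! v)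
                 (round-unique vs (vs⊆Z ∘ there) vs!)
                 (λ (z∈v , z∈vs) → let w , w∈vs , z∈w = find (∈-concatMap⁻ _ z∈vs) in apart w∈vs z∈v z∈w)
      where
      apart : ∀ {w z} → w ∈ vs → z ∈ v ∷ inner v → z ∈ w ∷ inner w → ⊥
      apart w∈vs (here refl) (here refl) = All.lookup v∉vs w∈vs refl
      apart w∈vs (here refl) (there z∈w) = inner-avoids z∈w (vs⊆Z (here refl))
      apart w∈vs (there z∈v) (here refl) = inner-avoids z∈v (vs⊆Z (there w∈vs))
      apart w∈vs (there z∈v) (there z∈w) = All.lookup v∉vs w∈vs (inner-disjoint z∈v z∈w)

  -- The bound on `3 * k` is r ≥ ⌊3k/2⌋ freed of the division.
  ordered : ∀ {k r} → Connected G → 3 ≤ k → 3 * k < 2 + 2 * r → Ordered k (power G r)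
  ordered {r = r} conn 3≤k bound vs@(v ∷ w ∷ ws) refl vs! =
    let next , next≡ = interpolate v vs! (sym (trans (length-++ (w ∷ ws)) (+-comm _ 1)))
        next∈ : ∀ {z} → z ∈ vs → next z ∈ vs
        next∈ {z} z∈ = rotate⁻ (subst (next z ∈_) next≡ (∈-map⁺ next z∈))
        ⊆next : ∀ {z} → z ∈ vs → z ∈ map next vs
        ⊆next {z} z∈ = subst (z ∈_) (sym next≡) (rotate⁺ z∈)
        L = linkage conn v next∈ ⊆next 0<r bound
        linked = All.tabulate λ σ∈ →
          Linkage.inner-linked L σ∈ (All.lookup (successor-≢ v (w ∷ ws) next≡ (linked-≢-cyclic vs!)) σ∈)
        u = round-unique L vs id vs!
    in round L vs
     , cycle (≤-trans 3≤k (Unique∧⊆⇒length≤ vs! (Sublist.lookup (⊆-round L vs)))) u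
             (round-linked L v (w ∷ ws) next≡ linked)
     , from (Sublist.++⁺ˡ (Linkage.inner L v) (⊆-round L (w ∷ ws)))
    where
    rotate⁺ : ∀ {z} → z ∈ v ∷ w ∷ ws → z ∈ w ∷ ws ++ v ∷ []
    rotate⁺ (here z≡v) = ∈-++⁺ʳ (w ∷ ws) (here z≡v)
    rotate⁺ (there z∈) = ∈-++⁺ˡ z∈
    rotate⁻ : ∀ {z} → z ∈ w ∷ ws ++ v ∷ [] → z ∈ v ∷ w ∷ ws
    rotate⁻ z∈ with ∈-++⁻ (w ∷ ws) z∈
    ... | inj₁ z∈ws       = there z∈ws
    ... | inj₂ (here z≡v) = here z≡v
    0<r : 0 < r
    -- 2 ≤ 9 ≤ 3k, hence 2 < 2 + 2r.
    0<r = *-cancelˡ-< 2 0 r (+-cancelˡ-< 2 _ _ (≤-trans (s≤s (≤-trans (m≤m+n 2 7) (*-monoʳ-≤ 3 3≤k))) bound))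
  ordered conn (s≤s ()) _ (_ ∷ []) refl _

  -- Insertion of the remaining vertices

  weight : Bool → ℕ
  weight false = 0
  weight true  = 1

  -- `false` is even and `true` odd. A step between even vertices has length at most r; an odd start
  -- allows one more, an odd end one less.
  Hop : ℕ → V × Bool → V × Bool → Set
  Hop r (u , b) (v , c) = ∃[ d ] (Walk G d u v × weight c + d ≤ weight b + r)

  hop⇒distanceAtMost : ∀ {r p q} → Hop r p q → DistanceAtMost G (r + 1) (proj₁ p) (proj₁ q)
  hop⇒distanceAtMost {r} {_ , b} {_ , c} (d , p , le) = walk⇒distanceAtMost
    (≤-trans (m≤n+m d (weight c)) (≤-trans le (≤-trans (+-monoˡ-≤ r (weight≤1 b)) (≤-reflexive (+-comm 1 r))))) p
    where
    weight≤1 : ∀ b → weight b ≤ 1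
    weight≤1 false = z≤n
    weight≤1 true  = ≤-refl

  -- The new vertex is odd. The step from `y` to `x` needs 1 + 1 ≤ r; the step out of `x` is one
  -- longer than the old step out of `y`, which the odd start allows.
  insertAfter : ∀ {r x y} → 2 ≤ r → Adj G x y → ∀ p L {q} → (y , false) ∈ p ∷ L → Linked (Hop r) (p ∷ L ++ q ∷ []) →
                ∃[ as ] ∃[ bs ] (L ≡ as ++ bs × Linked (Hop r) (p ∷ as ++ (x , true) ∷ bs ++ q ∷ []))
  insertAfter {r} {x} {y} 2≤r a p L (here refl) l = [] , L , refl , insertSecond L l
    where
    shift : ∀ {q} → Hop r (y , false) q → Hop r (x , true) q
    shift {_ , c} (d , w , le) = suc d , cons a w , ≤-trans (≤-reflexive (+-suc (weight c) d)) (s≤s le)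
    insertSecond : ∀ L {q} → Linked (Hop r) ((y , false) ∷ L ++ q ∷ []) →
                   Linked (Hop r) ((y , false) ∷ (x , true) ∷ L ++ q ∷ [])
    insertSecond []      (h ∷ l) = (1 , cons (symm G a) nil , 2≤r) ∷ shift h ∷ l
    insertSecond (_ ∷ _) (h ∷ l) = (1 , cons (symm G a) nil , 2≤r) ∷ shift h ∷ l
  insertAfter 2≤r a p (z ∷ L) (there y∈) (h ∷ l) with as , bs , refl , l′ ← insertAfter 2≤r a z L y∈ l =
    z ∷ as , bs , refl , h ∷ l′

  -- The new vertex is even. The step into `x` is one longer than the old step into `y`, whose odd
  -- end had cost one. Searching `L` suffices because the start of the cycle is even.
  insertBefore : ∀ {r x y} → 2 ≤ r → Adj G x y → ∀ p L {q} → (y , true) ∈ L → Linked (Hop r) (p ∷ L ++ q ∷ []) →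
                 ∃[ as ] ∃[ bs ] (L ≡ as ++ bs × Linked (Hop r) (p ∷ as ++ (x , false) ∷ bs ++ q ∷ []))
  insertBefore 2≤r a p L@(_ ∷ _) (here refl) ((d , w , le) ∷ l) =
    [] , L , refl , (suc d , snoc G w (symm G a) , le) ∷ (1 , cons a nil , 2≤r) ∷ l
  insertBefore 2≤r a p (z ∷ L) (there y∈) (h ∷ l) with as , bs , refl , l′ ← insertBefore 2≤r a z L y∈ l =
    z ∷ as , bs , refl , h ∷ l′

  insert! : ∀ as {bs : List V} {x} → x ∉ as ++ bs → Unique (as ++ bs) → Unique (as ++ x ∷ bs)
  insert! []       x∉ u = All.tabulate (λ { z∈ refl → x∉ z∈ }) ∷ u
  insert! (a ∷ as) {bs} {x} x∉ (a∉ ∷ u) =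
    All.++⁺ (All.++⁻ˡ as a∉) ((λ a≡x → x∉ (here (sym a≡x))) ∷ All.++⁻ʳ as a∉) ∷ insert! as (x∉ ∘ there) u

  -- Phrased as a property of the vertex list `D` to suit `exhaust`. The start `c` stays even, and
  -- `extends` preserves the order of the given cycle.
  record ColouredCycle (r : ℕ) (c : V) (xs D : List V) : Set where
    field
      others  : List (V × Bool)
      D≡      : D ≡ c ∷ map proj₁ others
      linked  : Linked (Hop r) ((c , false) ∷ others ++ (c , false) ∷ [])
      D!      : Unique D
      extends : xs ⊆ map proj₁ others

  module _ {r : ℕ} {c : V} {xs : List V} where

    enlarge : ∀ as bs {x b} → let D = c ∷ map proj₁ (as ++ bs) in
              Linked (Hop r) ((c , false) ∷ as ++ (x , b) ∷ bs ++ (c , false) ∷ []) →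
              Unique D → x ∉ D → xs ⊆ map proj₁ (as ++ bs) →
              ∃[ D′ ] (ColouredCycle r c xs D′ × length D′ ≡ suc (length D) × (∀ {z} → z ∈ D → z ∈ D′))
    enlarge as bs {x} {b} l D! x∉D xs⊆ rewrite map-++ proj₁ as bs = _ , record
      { others  = as ++ (x , b) ∷ bs
      ; D≡      = cong (c ∷_) (sym (map-++ proj₁ as _))
      ; linked  = subst (Linked (Hop r) ∘ ((c , false) ∷_)) (sym (++-assoc as _ _)) l
      ; D!      = insert! (c ∷ map proj₁ as) x∉D D!
      ; extends = ⊆-trans xs⊆ (subst (map proj₁ as ++ map proj₁ bs ⊆_) (sym (map-++ proj₁ as _)) insert⊆)
      } , length-++-sucʳ (c ∷ map proj₁ as) x (map proj₁ bs) , Sublist.lookup (refl ∷ insert⊆)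
      where
      insert⊆ : map proj₁ as ++ map proj₁ bs ⊆ map proj₁ as ++ x ∷ map proj₁ bs
      insert⊆ = Sublist.++⁺ ⊆-refl (x Sublist.∷ʳ ⊆-refl)

    coloured : ∀ L {y} → y ∈ c ∷ map proj₁ L → (y , false) ∈ (c , false) ∷ L ⊎ (y , true) ∈ L
    coloured L (here refl) = inj₁ (here refl)
    coloured L (there y∈) with ∈-map⁻ proj₁ y∈
    ... | (_ , false) , y∈L , refl = inj₁ (there y∈L)
    ... | (_ , true)  , y∈L , refl = inj₂ y∈L

    addNeighbour : 2 ≤ r → ∀ {D x y} → ColouredCycle r c xs D → y ∈ D → x ∉ D → Adj G x y →
                   ∃[ D′ ] (ColouredCycle r c xs D′ × length D′ ≡ suc (length D) × (∀ {z} → z ∈ D → z ∈ D′))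
    addNeighbour 2≤r record { others = L ; D≡ = refl ; linked = l ; D! = D! ; extends = xs⊆L } y∈D x∉D a
      with coloured L y∈D
    ... | inj₁ y∈ with as , bs , refl , l′ ← insertAfter 2≤r a (c , false) L y∈ l   = enlarge as bs l′ D! x∉D xs⊆L
    ... | inj₂ y∈ with as , bs , refl , l′ ← insertBefore 2≤r a (c , false) L y∈ l = enlarge as bs l′ D! x∉D xs⊆L

    colour : Unique (c ∷ xs) → Linked (Adj (power G r)) (c ∷ xs ++ c ∷ []) → ColouredCycle r c xs (c ∷ xs)
    colour u l = record
      { others  = map even xs
      ; D≡      = cong (c ∷_) (sym uncolour)
      ; linked  = subst (Linked (Hop r)) (map-++ even (c ∷ xs) (c ∷ []))
                    (Linked.map⁺ (Linked.map (λ { (_ , d , d≤r , p , _) → d , p , d≤r }) l))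
      ; D!      = u
      ; extends = subst (xs ⊆_) (sym uncolour) ⊆-refl
      }
      where
      even : V → V × Bool
      even v = v , false
      uncolour : map proj₁ (map even xs) ≡ xs
      uncolour = trans (sym (map-∘ xs)) (map-id xs)

  hamiltonianCycle : Connected G → ∀ {r c xs} → 2 ≤ r → IsCycle (power G r) (c ∷ xs) →
                     ∃[ ys ] (IsHamiltonianCycle (power G (r + 1)) (c ∷ ys) × xs ⊆ ys)
  hamiltonianCycle conn {r} {c} {xs} 2≤r (cycle 3≤ u l)
    with D , record { others = L ; D≡ = refl ; linked = l′ ; D! = D! ; extends = xs⊆L } , all∈ ←
           exhaust conn (ColouredCycle r c xs) ColouredCycle.D! (addNeighbour 2≤r) (here refl) (colour u l) =
    ys , (cycle 3≤′ D! (Linked.zipWith id (linked-≢ ys 3≤′ D! , near)) , all∈) , xs⊆L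
    where
    ys : List V
    ys = map proj₁ L
    3≤′ : 3 ≤ length (c ∷ ys)
    3≤′ = ≤-trans 3≤ (Unique∧⊆⇒length≤ u (Sublist.lookup (refl ∷ xs⊆L)))
    linked-≢ : ∀ ys → 3 ≤ length (c ∷ ys) → Unique (c ∷ ys) → Linked _≢_ (c ∷ ys ++ c ∷ [])
    linked-≢ []      (s≤s ()) _
    linked-≢ (_ ∷ _) _        D! = linked-≢-cyclic D!
    near : Linked (DistanceAtMost G (r + 1)) (c ∷ ys ++ c ∷ [])
    near = subst (Linked _) (map-++ proj₁ ((c , false) ∷ L) ((c , false) ∷ []))
             (Linked.map⁺ (Linked.map hop⇒distanceAtMost l′))

  orderedHamiltonian : ∀ {k r} → Connected G → 2 ≤ r → 1 ≤ k → Ordered k (power G r) → OrderedHamiltonian k (power G (r + 1))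
  orderedHamiltonian conn 2≤r 1≤k ord vs len vs! with ord vs len vs!
  orderedHamiltonian conn 2≤r () ord .[] refl vs! | _ , _ , none
  ... | _ , cyc , from vs⊆xs with ys , ham , xs⊆ys ← hamiltonianCycle conn 2≤r cyc = _ , ham , from (⊆-trans vs⊆xs xs⊆ys)

theorem4p4 : ∀ (k : ℕ) → 3 ≤ k → ∀ (n : ℕ) (G : Graph n) → Connected G → k ≤ n →
    Ordered k (power G (3 * k / 2)) × OrderedHamiltonian k (power G (3 * k / 2 + 1))
theorem4p4 k 3≤k n G conn k≤n = ord , orderedHamiltonian G conn 2≤r (≤-trans (s≤s z≤n) 3≤k) ord
  where
  open ≤-Reasoning
  r : ℕ
  r = 3 * k / 2
  3k<2+2r : 3 * k < 2 + 2 * r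
  3k<2+2r = begin-strict
    3 * k                   ≡⟨ m≡m%n+[m/n]*n (3 * k) 2 ⟩
    3 * k % 2 + r * 2       <⟨ +-monoˡ-< (r * 2) (m%n<n (3 * k) 2) ⟩
    2 + r * 2               ≡⟨ cong (2 +_) (*-comm r 2) ⟩
    2 + 2 * r               ∎
  2≤r : 2 ≤ r
  -- ⌊4/2⌋ ≤ ⌊3k/2⌋, as 4 ≤ 4 + 5 = 9 ≤ 3k.
  2≤r = /-monoˡ-≤ 2 (≤-trans (m≤m+n 4 5) (*-monoʳ-≤ 3 3≤k))
  ord : Ordered k (power G r)
  ord = ordered G conn 3≤k 3k<2+2r
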